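{- Let $G$ be a graph with edge set $E$, $k\ge1$, suppose $M_k(G)$ is a connected matroid, let $B$ be a base of $M_k(G)$ and $e\in B$, and let $A$ be the component of $G\langle B\rangle$ containing $e$. Suppose $A$ has at least two cycles and $e\in E(\lfloor A\rfloor)$. Then the fundamental cocircuit $K(e,B)$ equals $(E\setminus B)\cup\{e\}$.
   Context: Graphs are finite, may have loops and parallel edges, and have no isolated vertices. A leaf is a vertex incident to exactly one edge, which is not a loop. For $X\subseteq E$, $G\langle X\rangle$ is the subgraph with edge set $X$ and vertex set the vertices incident to $X$. For $k\ge0$, $M_k(G)$ is the matroid on $E$ whose circuits are the inclusion-minimal members of $\{C\subseteq E:C\neq\emptyset,\ |C|=|V(G\langle C\rangle)|+k\}$. A matroid is connected if its ground set has at least two elements and every two elements lie in a common circuit. For a base $B$ and $e\in B$, $K(e,B)$ is the unique cocircuit $K$ with $K\cap B=\{e\}$. For a connected graph $A$ containing a cycle, its kernel $\lfloor A\rfloor$ is the subgraph obtained by repeatedly deleting leaves (with their incident edges) until no leaf remains. -}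

module Defs where

open import Level using (0ℓ)
open import Data.Nat using (ℕ; _+_; _≤_)
open import Data.Fin using (Fin)
open import Data.Fin.Properties using (_≟_; any?)
open import Data.Fin.Subset
  using (Subset; _∈_; _⊆_; _∩_; _-_; ∁; ⁅_⁆; ∣_∣; Nonempty)
open import Data.Fin.Subset.Properties using (_∈?_)
open import Data.Product using (_×_; ∃; ∃₂)
open import Data.Sum using (_⊎_)
open import Data.Vec using (tabulate)
open import Relation.Binary using (Rel)
open import Relation.Binary.Construct.Closure.ReflexiveTransitive using (Star)
open import Relation.Binary.PropositionalEquality using (_≡_; _≢_)
open import Relation.Nullary using (¬_; Dec; does)
open import Relation.Nullary.Decidable using (_×-dec_; _⊎-dec_)
open import Relation.Unary using (Pred)

Minimal Maximal : ∀ {m} → Pred (Subset m) 0ℓ → Pred (Subset m) 0ℓ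
Minimal P X = P X × (∀ Y → P Y → Y ⊆ X → Y ≡ X)
Maximal P X = P X × (∀ Y → P Y → X ⊆ Y → Y ≡ X)

-- A matroid on Fin m is presented by its family 𝒞 of circuits.
module Matroid {m : ℕ} (𝒞 : Pred (Subset m) 0ℓ) where

  Independent : Pred (Subset m) 0ℓ
  Independent X = ∀ C → 𝒞 C → ¬ (C ⊆ X)

  Base : Pred (Subset m) 0ℓ
  Base = Maximal Independent

  -- The bases of the dual matroid are the complements of the bases, its
  -- independent sets are the subsets of those complements, and the cocircuits
  -- are the circuits (minimal dependent sets) of the dual.
  Coindependent : Pred (Subset m) 0ℓ
  Coindependent X = ∃ λ B → Base B × X ⊆ ∁ B

  Cocircuit : Pred (Subset m) 0ℓ
  Cocircuit = Minimal (λ X → ¬ Coindependent X)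

  ConnectedMatroid : Set
  ConnectedMatroid =
    2 ≤ m × (∀ (e f : Fin m) → e ≢ f → ∃ λ C → 𝒞 C × e ∈ C × f ∈ C)

  -- K is the fundamental cocircuit K(e,B).
  IsFundamentalCocircuit : Fin m → Subset m → Subset m → Set
  IsFundamentalCocircuit e B K =
    Cocircuit K × K ∩ B ≡ ⁅ e ⁆ ×
    (∀ K′ → Cocircuit K′ → K′ ∩ B ≡ ⁅ e ⁆ → K′ ≡ K)

-- Vertex set Fin n, edge set Fin m.  The order of the two ends of an edge
-- carries no meaning: every notion below is symmetric in end₁ and end₂.
record Graph (n m : ℕ) : Set where
  field
    end₁ end₂ : Fin m → Fin n

  Incident : Fin m → Fin n → Set
  Incident f v = end₁ f ≡ v ⊎ end₂ f ≡ v

  field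
    noIsolated : ∀ v → ∃ λ f → Incident f v

  incident? : ∀ f v → Dec (Incident f v)
  incident? f v = (end₁ f ≟ v) ⊎-dec (end₂ f ≟ v)

  Loop : Fin m → Set
  Loop f = end₁ f ≡ end₂ f

  -- Since graphs have no isolated vertices, every subgraph is G⟨ X ⟩ for its
  -- edge set X, so subgraphs are given by their edge sets; V⟨ X ⟩ is the vertex
  -- set of G⟨ X ⟩.
  V⟨_⟩ : Subset m → Subset n
  V⟨ X ⟩ = tabulate λ v → does (any? λ f → (f ∈? X) ×-dec incident? f v)

  Adjacent : Subset m → Rel (Fin n) 0ℓ
  Adjacent X u v = ∃ λ f → f ∈ X ×
    ((end₁ f ≡ u × end₂ f ≡ v) ⊎ (end₁ f ≡ v × end₂ f ≡ u))

  Connected : Pred (Subset m) 0ℓ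
  Connected X = ∀ u v → u ∈ V⟨ X ⟩ → v ∈ V⟨ X ⟩ → Star (Adjacent X) u v

  ComponentOf : Subset m → Pred (Subset m) 0ℓ
  ComponentOf X = Maximal (λ Y → Y ⊆ X × Nonempty Y × Connected Y)

  -- Number of edge ends at v: a loop contributes 2.
  degree : Subset m → Fin n → ℕ
  degree X v = ∣ X ∩ tabulate (λ f → does (end₁ f ≟ v)) ∣
             + ∣ X ∩ tabulate (λ f → does (end₂ f ≟ v)) ∣

  -- Connected and 2-regular; includes single loops and pairs of parallel edges.
  Cycle : Pred (Subset m) 0ℓ
  Cycle C = Nonempty C × Connected C × (∀ v → v ∈ V⟨ C ⟩ → degree C v ≡ 2)

  AtLeastTwoCycles : Pred (Subset m) 0ℓ
  AtLeastTwoCycles X =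
    ∃₂ λ C D → C ≢ D × Cycle C × Cycle D × C ⊆ X × D ⊆ X

  -- v is a leaf of G⟨ X ⟩ and f is its only incident edge.
  LeafAt : Subset m → Fin n → Fin m → Set
  LeafAt X v f =
    f ∈ X × Incident f v × ¬ Loop f × (∀ g → g ∈ X → Incident g v → g ≡ f)

  -- In a connected graph containing a cycle, deleting a leaf never isolates
  -- its neighbour, so deleting the leaf amounts to deleting its edge.
  DeleteLeaf : Rel (Subset m) 0ℓ
  DeleteLeaf X Y = ∃₂ λ v f → LeafAt X v f × Y ≡ X - f

  -- G⟨ L ⟩ is the kernel of G⟨ A ⟩, for G⟨ A ⟩ connected and containing a cycle.
  IsKernel : Subset m → Subset m → Set
  IsKernel A L = Star DeleteLeaf A L × (∀ v f → ¬ LeafAt L v f)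

open Graph public

-- The circuits of M_k(G).
M : ∀ {n m} → ℕ → Graph n m → Pred (Subset m) 0ℓ
M k G = Minimal (λ C → Nonempty C × ∣ C ∣ ≡ ∣ V⟨_⟩ G C ∣ + k)

{-# OPTIONS --safe #-}
-- Write ex X = |X| − |V⟨X⟩|, so that X is independent in M_k(G) iff ex Y < k for
-- every nonempty Y ⊆ X.  The function ex is supermodular, and it does not decrease
-- when a subgraph grows inside a connected graph A by an edge that touches it; it
-- stays constant only if that edge hangs a leaf.  Hence a nonempty Y ⊆ A satisfies
-- ex Y ≤ ex A, and if equality holds then every leafless subgraph of A, in
-- particular the kernel, lies in Y.  Cycles C have ex C ≥ 0, so if ex A ≤ 0, any two
-- cycles of A would contain each other; hence ex A ≥ 1.  If C is the fundamental
-- circuit of f ∉ B, then ex (C − f) ≥ k − 1 ≥ ex ((C − f) ∪ A), so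
-- ex (A ∩ (C − f)) ≥ ex A by supermodularity and e lies in C.  Therefore B − e + f
-- is a base for every f ∉ B.
module Submission where

open import Defs
open import Level using (0ℓ)
open import Data.Nat using (ℕ; _≤_; _<_; _+_; suc; z≤n; s≤s; s≤s⁻¹; _≤?_)
open import Data.Nat.Properties as ℕ using (module ≤-Reasoning)
open import Data.Nat.Tactic.RingSolver using (solve-∀)
open import Data.Fin using (Fin)
open import Data.Fin.Properties using (_≟_; any?)
open import Data.Fin.Subset
  using (Subset; inside; outside; _∈_; _∉_; _⊆_; _⊈_; _⊂_; _⊃_; _∪_; _∩_; _-_; ∁; ⁅_⁆; Nonempty)
  renaming (∣_∣ to infix 10 #_)
open import Data.Fin.Subset.Properties
open import Data.Fin.Subset.Induction using (⊂-wellFounded; ⊃-wellFounded)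
open import Data.Empty using (⊥; ⊥-elim)
open import Data.Product using (_×_; _,_; ∃; proj₁; proj₂)
open import Data.Sum using (_⊎_; inj₁; inj₂)
open import Data.Vec using ([]; _∷_; tabulate)
open import Data.Vec.Properties using (lookup∘tabulate; []=⇒lookup; lookup⇒[]=)
open import Function using (_∘_)
open import Induction.WellFounded using (Acc; acc)
open import Relation.Binary.Construct.Closure.ReflexiveTransitive using (Star; ε; _◅_)
open import Relation.Binary.PropositionalEquality
open import Relation.Nullary using (¬_; yes; no; does; contradiction)
open import Relation.Nullary.Decidable using (_×-dec_; ¬?; dec-true; decidable-stable)
open import Relation.Unary using (Pred; Decidable)

-- Finite subsets

module _ {n : ℕ} {P : Pred (Fin n) 0ℓ} (P? : Decidable P) where

  ∈-tabulate⁺ : ∀ {x} → P x → x ∈ tabulate (does ∘ P?)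
  ∈-tabulate⁺ {x} px =
    lookup⇒[]= x _ (trans (lookup∘tabulate _ x) (dec-true (P? x) px))

  ∈-tabulate⁻ : ∀ {x} → x ∈ tabulate (does ∘ P?) → P x
  ∈-tabulate⁻ {x} x∈ with P? x | trans (sym (lookup∘tabulate (does ∘ P?) x)) ([]=⇒lookup x∈)
  ... | yes px | _ = px

module _ {n : ℕ} where

  ⊈-witness : {p q : Subset n} → p ⊈ q → ∃ λ x → x ∈ p × x ∉ q
  ⊈-witness {p} {q} p⊈q with any? (λ x → (x ∈? p) ×-dec ¬? (x ∈? q))
  ... | yes w = w
  ... | no ¬w = contradiction
    (λ {x} x∈p → decidable-stable (x ∈? q) (λ x∉q → ¬w (x , x∈p , x∉q))) p⊈q

  <-witness : {p q : Subset n} → # p < # q → ∃ λ x → x ∈ q × x ∉ p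
  <-witness p<q = ⊈-witness λ q⊆p → ℕ.<⇒≱ p<q (p⊆q⇒∣p∣≤∣q∣ q⊆p)

  ∪-lub : {p q r : Subset n} → p ⊆ r → q ⊆ r → p ∪ q ⊆ r
  ∪-lub {p} {q} p⊆r q⊆r x∈ with x∈p∪q⁻ p q x∈
  ... | inj₁ x∈p = p⊆r x∈p
  ... | inj₂ x∈q = q⊆r x∈q

  ⁅⁆-⊆ : ∀ {x} {p : Subset n} → x ∈ p → ⁅ x ⁆ ⊆ p
  ⁅⁆-⊆ {x} x∈p y∈ with refl ← x∈⁅y⁆⇒x≡y x y∈ = x∈p

  p-x⊆p : (p : Subset n) (x : Fin n) → p - x ⊆ p
  p-x⊆p p x = p─q⊆p p ⁅ x ⁆

  ⊆-insert⁻ : ∀ {x} {p q : Subset n} → p ⊆ q ∪ ⁅ x ⁆ → x ∉ p → p ⊆ q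
  ⊆-insert⁻ {x} {q = q} p⊆ x∉p y∈p with x∈p∪q⁻ q ⁅ x ⁆ (p⊆ y∈p)
  ... | inj₁ y∈q = y∈q
  ... | inj₂ y∈x with refl ← x∈⁅y⁆⇒x≡y x y∈x = contradiction y∈p x∉p

  ⊂-insert : ∀ {x} {p : Subset n} → x ∉ p → p ⊂ p ∪ ⁅ x ⁆
  ⊂-insert {x} {p} x∉p = p⊆p∪q ⁅ x ⁆ , x , q⊆p∪q p ⁅ x ⁆ (x∈⁅x⁆ x) , x∉p

  x∉p-x : (p : Subset n) (x : Fin n) → x ∉ p - x
  -- If `x` survived in `p - x`, removing it again would shrink the set, yet removal is idempotent.
  x∉p-x p x x∈ = ℕ.<-irrefl (cong #_ (p─q─q≡p─q p ⁅ x ⁆)) (x∈p⇒∣p-x∣<∣p∣ x∈)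

  p⊆p-x∪x : (p : Subset n) (x : Fin n) → p ⊆ (p - x) ∪ ⁅ x ⁆
  p⊆p-x∪x p x {y} y∈p with y ≟ x
  ... | yes refl = q⊆p∪q (p - x) ⁅ x ⁆ (x∈⁅x⁆ x)
  ... | no y≢x = p⊆p∪q ⁅ x ⁆ (x∈p∧x≢y⇒x∈p-y y∈p y≢x)

∣p∪q∣+∣p∩q∣≡∣p∣+∣q∣ : ∀ {n} (p q : Subset n) → # (p ∪ q) + # (p ∩ q) ≡ # p + # q
∣p∪q∣+∣p∩q∣≡∣p∣+∣q∣ [] [] = refl
∣p∪q∣+∣p∩q∣≡∣p∣+∣q∣ (outside ∷ p) (outside ∷ q) = ∣p∪q∣+∣p∩q∣≡∣p∣+∣q∣ p q
∣p∪q∣+∣p∩q∣≡∣p∣+∣q∣ (inside ∷ p) (outside ∷ q) = cong suc (∣p∪q∣+∣p∩q∣≡∣p∣+∣q∣ p q)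
∣p∪q∣+∣p∩q∣≡∣p∣+∣q∣ (outside ∷ p) (inside ∷ q) =
  trans (cong suc (∣p∪q∣+∣p∩q∣≡∣p∣+∣q∣ p q)) (sym (ℕ.+-suc (# p) (# q)))
∣p∪q∣+∣p∩q∣≡∣p∣+∣q∣ (inside ∷ p) (inside ∷ q) =
  cong suc (trans (ℕ.+-suc (# (p ∪ q)) (# (p ∩ q)))
    (trans (cong suc (∣p∪q∣+∣p∩q∣≡∣p∣+∣q∣ p q)) (sym (ℕ.+-suc (# p) (# q)))))

module _ {n : ℕ} where

  ∣p∪q∣≤∣p∣+∣q∣ : (p q : Subset n) → # (p ∪ q) ≤ # p + # q
  ∣p∪q∣≤∣p∣+∣q∣ p q =
    ℕ.≤-trans (ℕ.m≤m+n _ _) (ℕ.≤-reflexive (∣p∪q∣+∣p∩q∣≡∣p∣+∣q∣ p q))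

  ∣p∪x∣≤1+∣p∣ : (p : Subset n) (x : Fin n) → # (p ∪ ⁅ x ⁆) ≤ suc (# p)
  ∣p∪x∣≤1+∣p∣ p x = begin
    # (p ∪ ⁅ x ⁆) ≤⟨ ∣p∪q∣≤∣p∣+∣q∣ p ⁅ x ⁆ ⟩
    # p + # ⁅ x ⁆ ≡⟨ cong (# p +_) (∣⁅x⁆∣≡1 x) ⟩
    # p + 1       ≡⟨ ℕ.+-comm (# p) 1 ⟩
    suc (# p)     ∎
    where open ≤-Reasoning

  ∣p∣≤1+∣p-x∣ : (p : Subset n) (x : Fin n) → # p ≤ suc (# (p - x))
  ∣p∣≤1+∣p-x∣ p x = ℕ.≤-trans (p⊆q⇒∣p∣≤∣q∣ (p⊆p-x∪x p x)) (∣p∪x∣≤1+∣p∣ (p - x) x)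

  0<∣p∣⇒Nonempty : (p : Subset n) → 0 < # p → Nonempty p
  0<∣p∣⇒Nonempty p 0<p = let x , x∈p , _ = <-witness {p = Data.Fin.Subset.⊥}
                               (subst (_< # p) (sym (∣⊥∣≡0 n)) 0<p)
                         in x , x∈p

  -- Bounds a degree at a leaf: `p` and `q` stand for the edges whose first, respectively second,
  -- end is the leaf, and only a loop lies in both.
  disjoint-⊆⁅⁆ : ∀ x (p q : Subset n) → p ⊆ ⁅ x ⁆ → q ⊆ ⁅ x ⁆ →
                 ¬ (x ∈ p × x ∈ q) → # p + # q ≤ 1
  disjoint-⊆⁅⁆ x p q p⊆x q⊆x disj = begin
    # p + # q             ≡⟨ ∣p∪q∣+∣p∩q∣≡∣p∣+∣q∣ p q ⟨
    # (p ∪ q) + # (p ∩ q) ≤⟨ ℕ.+-mono-≤ (p⊆q⇒∣p∣≤∣q∣ (∪-lub p⊆x q⊆x)) (ℕ.≤-reflexive p∩q≡0) ⟩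
    # ⁅ x ⁆ + 0           ≡⟨ trans (ℕ.+-identityʳ _) (∣⁅x⁆∣≡1 x) ⟩
    1                     ∎
    where
    open ≤-Reasoning
    p∩q≡0 : # (p ∩ q) ≡ 0
    p∩q≡0 = trans (cong #_ (Empty-unique {p = p ∩ q} λ (y , y∈) →
      let y∈p , y∈q = x∈p∩q⁻ p q y∈
          y≡x = x∈⁅y⁆⇒x≡y x (p⊆x y∈p)
      in disj (subst (_∈ p) y≡x y∈p , subst (_∈ q) y≡x y∈q))) (∣⊥∣≡0 n)

-- Excess of subgraphs

module _ {n m : ℕ} (G : Graph n m) where

  V : Subset m → Subset n
  V = V⟨_⟩ G

  Leafless : Pred (Subset m) 0ℓ
  Leafless X = ∀ v f → ¬ LeafAt G X v f

  ∈-V⁺ : ∀ {X f v} → f ∈ X → Incident G f v → v ∈ V X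
  ∈-V⁺ {X} f∈X inc =
    ∈-tabulate⁺ (λ v → any? λ f → (f ∈? X) ×-dec incident? G f v) (_ , f∈X , inc)

  ∈-V⁻ : ∀ {X v} → v ∈ V X → ∃ λ f → f ∈ X × Incident G f v
  ∈-V⁻ {X} = ∈-tabulate⁻ (λ v → any? λ f → (f ∈? X) ×-dec incident? G f v)

  V-mono : ∀ {X Y} → X ⊆ Y → V X ⊆ V Y
  V-mono X⊆Y v∈ = let f , f∈X , inc = ∈-V⁻ v∈ in ∈-V⁺ (X⊆Y f∈X) inc

  ∣V∣-mono : ∀ {X Y} → X ⊆ Y → # V X ≤ # V Y
  ∣V∣-mono X⊆Y = p⊆q⇒∣p∣≤∣q∣ (V-mono X⊆Y)

  V-∪ : ∀ X Y → V (X ∪ Y) ⊆ V X ∪ V Y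
  V-∪ X Y v∈ with f , f∈ , inc ← ∈-V⁻ v∈ with x∈p∪q⁻ X Y f∈
  ... | inj₁ f∈X = p⊆p∪q (V Y) (∈-V⁺ f∈X inc)
  ... | inj₂ f∈Y = q⊆p∪q (V X) (V Y) (∈-V⁺ f∈Y inc)

  V-∩ : ∀ X Y → V (X ∩ Y) ⊆ V X ∩ V Y
  V-∩ X Y v∈ = x∈p∩q⁺ (V-mono (p∩q⊆p X Y) v∈ , V-mono (p∩q⊆q X Y) v∈)

  -- `V` carries intersections only into subsets of intersections, while cardinality is modular.
  -- This is the supermodularity of ex.
  ∣V∣-submodular : ∀ X Y → # V (X ∪ Y) + # V (X ∩ Y) ≤ # V X + # V Y
  ∣V∣-submodular X Y = begin
    # V (X ∪ Y) + # V (X ∩ Y)     ≤⟨ ℕ.+-mono-≤ (p⊆q⇒∣p∣≤∣q∣ (V-∪ X Y)) (p⊆q⇒∣p∣≤∣q∣ (V-∩ X Y)) ⟩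
    # (V X ∪ V Y) + # (V X ∩ V Y) ≡⟨ ∣p∪q∣+∣p∩q∣≡∣p∣+∣q∣ (V X) (V Y) ⟩
    # V X + # V Y                 ∎
    where open ≤-Reasoning

  -- ex X ≤ ex Y, without subtraction.
  _≼_ : Subset m → Subset m → Set
  X ≼ Y = # X + # V Y ≤ # Y + # V X

  ≼-trans : ∀ {X Y Z} → X ≼ Y → Y ≼ Z → X ≼ Z
  ≼-trans {X} {Y} {Z} X≼Y Y≼Z = ℕ.+-cancelʳ-≤ (# Y + # V Y) _ _ (begin
    # X + # V Z + (# Y + # V Y) ≡⟨ lhs (# X) (# V Z) (# Y) (# V Y) ⟩
    # X + # V Y + (# Y + # V Z) ≤⟨ ℕ.+-mono-≤ X≼Y Y≼Z ⟩
    # Y + # V X + (# Z + # V Y) ≡⟨ rhs (# Y) (# V X) (# Z) (# V Y) ⟩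
    # Z + # V X + (# Y + # V Y) ∎)
    where
    open ≤-Reasoning
    lhs : ∀ a b c d → a + b + (c + d) ≡ a + d + (c + b)
    lhs = solve-∀
    rhs : ∀ a b c d → a + b + (c + d) ≡ c + b + (a + d)
    rhs = solve-∀

  -- Adding one edge to a subgraph

  opposite : ∀ g u → Incident G g u → ∃ λ w → ∀ v → Incident G g v → v ≡ u ⊎ v ≡ w
  opposite g u (inj₁ refl) = end₂ G g , λ { v (inj₁ refl) → inj₁ refl ; v (inj₂ refl) → inj₂ refl }
  opposite g u (inj₂ refl) = end₁ G g , λ { v (inj₁ refl) → inj₂ refl ; v (inj₂ refl) → inj₁ refl }

  loop-ends : ∀ {g u v} → Loop G g → Incident G g u → Incident G g v → u ≡ v
  loop-ends l (inj₁ refl) (inj₁ refl) = refl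
  loop-ends l (inj₁ refl) (inj₂ refl) = l
  loop-ends l (inj₂ refl) (inj₁ refl) = sym l
  loop-ends l (inj₂ refl) (inj₂ refl) = refl

  -- One end of `g` is an old vertex, so only the opposite end can be new.
  ∣V-insert∣ : ∀ {Y g u} → u ∈ V Y → Incident G g u → # V (Y ∪ ⁅ g ⁆) ≤ suc (# V Y)
  ∣V-insert∣ {Y} {g} {u} u∈ inc with w , ends ← opposite g u inc =
    ℕ.≤-trans (p⊆q⇒∣p∣≤∣q∣ sub) (∣p∪x∣≤1+∣p∣ (V Y) w)
    where
    sub : V (Y ∪ ⁅ g ⁆) ⊆ V Y ∪ ⁅ w ⁆
    sub v∈ with f , f∈ , finc ← ∈-V⁻ v∈ with x∈p∪q⁻ Y ⁅ g ⁆ f∈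
    ... | inj₁ f∈Y = p⊆p∪q ⁅ w ⁆ (∈-V⁺ f∈Y finc)
    ... | inj₂ f∈g with refl ← x∈⁅y⁆⇒x≡y g f∈g with ends _ finc
    ... | inj₁ refl = p⊆p∪q ⁅ w ⁆ u∈
    ... | inj₂ refl = q⊆p∪q (V Y) ⁅ w ⁆ (x∈⁅x⁆ w)

  ≼-insert : ∀ {Y g u} → g ∉ Y → u ∈ V Y → Incident G g u → Y ≼ (Y ∪ ⁅ g ⁆)
  ≼-insert {Y} {g} g∉Y u∈ inc = begin
    # Y + # V (Y ∪ ⁅ g ⁆) ≤⟨ ℕ.+-monoʳ-≤ (# Y) (∣V-insert∣ u∈ inc) ⟩
    # Y + suc (# V Y)     ≡⟨ ℕ.+-suc (# Y) (# V Y) ⟩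
    suc (# Y) + # V Y     ≤⟨ ℕ.+-monoˡ-≤ (# V Y) (p⊂q⇒∣p∣<∣q∣ (⊂-insert g∉Y)) ⟩
    # (Y ∪ ⁅ g ⁆) + # V Y ∎
    where open ≤-Reasoning

  -- The edge count rises, so the excess can fail to grow only if the vertex count rises too.
  insert-fresh : ∀ {Y g} → g ∉ Y → (Y ∪ ⁅ g ⁆) ≼ Y → ∃ λ v → v ∈ V (Y ∪ ⁅ g ⁆) × v ∉ V Y
  insert-fresh {Y} {g} g∉Y Y+g≼Y = <-witness (ℕ.+-cancelˡ-≤ (# Y) _ _ (begin
    # Y + suc (# V Y)     ≡⟨ ℕ.+-suc (# Y) (# V Y) ⟩
    suc (# Y) + # V Y     ≤⟨ ℕ.+-monoˡ-≤ (# V Y) (p⊂q⇒∣p∣<∣q∣ (⊂-insert g∉Y)) ⟩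
    # (Y ∪ ⁅ g ⁆) + # V Y ≤⟨ Y+g≼Y ⟩
    # Y + # V (Y ∪ ⁅ g ⁆) ∎))
    where open ≤-Reasoning

  -- A new vertex meets no edge of `Y`, which leaves only `g`; and `g` is not a loop because it also
  -- meets the old vertex `u`.
  insert-leaf : ∀ {Y g u v} → u ∈ V Y → Incident G g u →
                v ∈ V (Y ∪ ⁅ g ⁆) → v ∉ V Y → LeafAt G (Y ∪ ⁅ g ⁆) v g
  insert-leaf {Y} {g} {u} {v} u∈ inc v∈ v∉ =
    q⊆p∪q Y ⁅ g ⁆ (x∈⁅x⁆ g) , ginc
    , (λ loop → v∉ (subst (_∈ V Y) (loop-ends loop inc ginc) u∈)) , only
    where
    only : ∀ h → h ∈ Y ∪ ⁅ g ⁆ → Incident G h v → h ≡ g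
    only h h∈ hinc with x∈p∪q⁻ Y ⁅ g ⁆ h∈
    ... | inj₁ h∈Y = contradiction (∈-V⁺ h∈Y hinc) v∉
    ... | inj₂ h∈g = x∈⁅y⁆⇒x≡y g h∈g
    ginc : Incident G g v
    ginc = let h , h∈ , hinc = ∈-V⁻ v∈
           in subst (λ f → Incident G f v) (only h h∈ hinc) hinc

  leafAt-⊆ : ∀ {L X v g} → L ⊆ X → g ∈ L → LeafAt G X v g → LeafAt G L v g
  leafAt-⊆ L⊆X g∈L (_ , inc , ¬loop , only) = g∈L , inc , ¬loop , λ h h∈L → only h (L⊆X h∈L)

  -- Growing a subgraph inside a connected graph

  module _ {A : Subset m} (conn : Connected G A) where

    -- Following the path along edges of `Y` keeps the current vertex in `V Y`. The first edge
    -- outside `Y` serves as `g`; if there is none, the path arrives at an end of `h`, and `h`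
    -- itself serves.
    escaping-edge : ∀ {Y u h} → u ∈ V Y → Star (Adjacent G A) u (end₁ G h) → h ∈ A → h ∉ Y →
                    ∃ λ g → g ∈ A × g ∉ Y × ∃ λ w → w ∈ V Y × Incident G g w
    escaping-edge {h = h} u∈ ε h∈A h∉Y = h , h∈A , h∉Y , _ , u∈ , inj₁ refl
    escaping-edge {Y} u∈ ((g , g∈A , ends) ◅ path) h∈A h∉Y with g ∈? Y | ends
    ... | yes g∈Y | inj₁ (_ , t) = escaping-edge (∈-V⁺ g∈Y (inj₂ t)) path h∈A h∉Y
    ... | yes g∈Y | inj₂ (t , _) = escaping-edge (∈-V⁺ g∈Y (inj₁ t)) path h∈A h∉Y
    ... | no g∉Y  | inj₁ (s , _) = g , g∈A , g∉Y , _ , u∈ , inj₁ s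
    ... | no g∉Y  | inj₂ (_ , s) = g , g∈A , g∉Y , _ , u∈ , inj₂ s

    -- Induction downwards from `A`: as long as `Y` is not all of `A`, connectedness supplies an
    -- edge that touches `Y`, and adding it brings `Y` closer to `A`.
    grow-induction : (P : Pred (Subset m) 0ℓ) → P A →
      (∀ {Y g u} → Y ⊆ A → g ∈ A → g ∉ Y → u ∈ V Y → Incident G g u → P (Y ∪ ⁅ g ⁆) → P Y) →
      ∀ {Y} → Nonempty Y → Y ⊆ A → P Y
    grow-induction P pA step = go (⊃-wellFounded _)
      where
      go : ∀ {Y} → Acc _⊃_ Y → Nonempty Y → Y ⊆ A → P Y
      go {Y} (acc rs) (y , y∈Y) Y⊆A with A ⊆? Y
      ... | yes A⊆Y = subst P (⊆-antisym A⊆Y Y⊆A) pA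
      ... | no A⊈Y with h , h∈A , h∉Y ← ⊈-witness A⊈Y
        with g , g∈A , g∉Y , u , u∈ , inc ←
          escaping-edge (∈-V⁺ y∈Y (inj₁ refl))
            (conn _ _ (∈-V⁺ (Y⊆A y∈Y) (inj₁ refl)) (∈-V⁺ h∈A (inj₁ refl))) h∈A h∉Y
        = step Y⊆A g∈A g∉Y u∈ inc
            (go (rs (⊂-insert g∉Y)) (y , p⊆p∪q ⁅ g ⁆ y∈Y) (∪-lub Y⊆A (⁅⁆-⊆ g∈A)))

    ≼-connected : ∀ {Y} → Nonempty Y → Y ⊆ A → Y ≼ A
    ≼-connected = grow-induction (_≼ A) ℕ.≤-refl λ {Y} {g} _ _ g∉Y u∈ inc Y+g≼A →
      ≼-trans {Y} {Y ∪ ⁅ g ⁆} {A} (≼-insert g∉Y u∈ inc) Y+g≼A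

    -- `Y` already has the full excess of `A`, so every edge `g` added on the way up hangs a leaf.
    -- If `L` used `g`, that leaf would be a leaf of `L`.
    leafless-⊆ : ∀ {L} → Leafless L → L ⊆ A → ∀ {Y} → Nonempty Y → Y ⊆ A → A ≼ Y → L ⊆ Y
    leafless-⊆ {L} leafless L⊆A = grow-induction (λ Y → A ≼ Y → L ⊆ Y) (λ _ → L⊆A) step
      where
      step : ∀ {Y g u} → Y ⊆ A → g ∈ A → g ∉ Y → u ∈ V Y → Incident G g u →
             (A ≼ (Y ∪ ⁅ g ⁆) → L ⊆ Y ∪ ⁅ g ⁆) → A ≼ Y → L ⊆ Y
      step {Y} {g} Y⊆A g∈A g∉Y u∈ inc ih A≼Y = ⊆-insert⁻ L⊆Y+g λ g∈L →
        let v , v∈ , v∉ = insert-fresh g∉Y Y+g≼Y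
        in leafless v g (leafAt-⊆ L⊆Y+g g∈L (insert-leaf u∈ inc v∈ v∉))
        where
        L⊆Y+g : L ⊆ Y ∪ ⁅ g ⁆
        L⊆Y+g = ih (≼-trans {A} {Y} {Y ∪ ⁅ g ⁆} A≼Y (≼-insert g∉Y u∈ inc))
        -- The enlarged set still lies in `A`, so its excess is at most that of `A`, hence at most
        -- that of `Y`.
        Y+g≼Y : (Y ∪ ⁅ g ⁆) ≼ Y
        Y+g≼Y = ≼-trans {Y ∪ ⁅ g ⁆} {A} {Y}
          (≼-connected (g , q⊆p∪q Y ⁅ g ⁆ (x∈⁅x⁆ g)) (∪-lub Y⊆A (⁅⁆-⊆ g∈A))) A≼Y

  -- Cycles and kernels

  ∣V⁅⁆∣≤2 : ∀ f → # V ⁅ f ⁆ ≤ 2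
  ∣V⁅⁆∣≤2 f = begin
    # V ⁅ f ⁆                       ≤⟨ p⊆q⇒∣p∣≤∣q∣ sub ⟩
    # (⁅ end₁ G f ⁆ ∪ ⁅ end₂ G f ⁆) ≤⟨ ∣p∪x∣≤1+∣p∣ ⁅ end₁ G f ⁆ (end₂ G f) ⟩
    suc (# ⁅ end₁ G f ⁆)            ≡⟨ cong suc (∣⁅x⁆∣≡1 (end₁ G f)) ⟩
    2                               ∎
    where
    open ≤-Reasoning
    sub : V ⁅ f ⁆ ⊆ ⁅ end₁ G f ⁆ ∪ ⁅ end₂ G f ⁆
    sub v∈ with h , h∈ , inc ← ∈-V⁻ v∈ with refl ← x∈⁅y⁆⇒x≡y f h∈ with inc
    ... | inj₁ refl = p⊆p∪q _ (x∈⁅x⁆ _)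
    ... | inj₂ refl = q⊆p∪q ⁅ end₁ G f ⁆ _ (x∈⁅x⁆ _)

  ∣V⁅loop⁆∣≤1 : ∀ {f} → Loop G f → # V ⁅ f ⁆ ≤ 1
  ∣V⁅loop⁆∣≤1 {f} loop = ℕ.≤-trans (p⊆q⇒∣p∣≤∣q∣ sub) (ℕ.≤-reflexive (∣⁅x⁆∣≡1 (end₁ G f)))
    where
    sub : V ⁅ f ⁆ ⊆ ⁅ end₁ G f ⁆
    sub v∈ with h , h∈ , inc ← ∈-V⁻ v∈ with refl ← x∈⁅y⁆⇒x≡y f h∈ =
      subst (_∈ ⁅ end₁ G f ⁆) (loop-ends loop (inj₁ refl) inc) (x∈⁅x⁆ _)

  -- At a leaf only `f` contributes edge ends, and only a loop contributes twice, so the degree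
  -- would be at most one.
  cycle-leafless : ∀ {C} → Cycle G C → Leafless C
  cycle-leafless {C} (_ , _ , two) v f (f∈C , inc , ¬loop , only) =
    ℕ.<-irrefl refl (ℕ.≤-trans (ℕ.≤-reflexive (sym (two v (∈-V⁺ f∈C inc))))
      (disjoint-⊆⁅⁆ f _ _ (sub first? inj₁) (sub second? inj₂) λ (f∈₁ , f∈₂) →
        ¬loop (trans (∈-tabulate⁻ first? (proj₂ (x∈p∩q⁻ C _ f∈₁)))
          (sym (∈-tabulate⁻ second? (proj₂ (x∈p∩q⁻ C _ f∈₂)))))))
    where
    first? = λ h → end₁ G h ≟ v
    second? = λ h → end₂ G h ≟ v
    sub : {P : Pred (Fin m) 0ℓ} (P? : Decidable P) → (∀ {h} → P h → Incident G h v) →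
          C ∩ tabulate (does ∘ P?) ⊆ ⁅ f ⁆
    sub P? P⇒inc {h} h∈ =
      let h∈C , h∈P = x∈p∩q⁻ C _ h∈
      in subst (_∈ ⁅ f ⁆) (sym (only h h∈C (P⇒inc (∈-tabulate⁻ P? h∈P)))) (x∈⁅x⁆ f)

  -- Compare `C` with a single edge `f`, of excess 0 for a loop and -1 otherwise. If ex C were
  -- negative, `f` would not be a loop and ex C would not exceed ex {f}; then `leafless-⊆`, with `C`
  -- in both roles, gives `C ⊆ ⁅ f ⁆`, and `f` hangs a leaf.
  leafless-excess : ∀ {C} → Nonempty C → Connected G C → Leafless C → # V C ≤ # C
  leafless-excess {C} (f , f∈C) conn leafless = decidable-stable (_ ≤? _) absurd
    where
    open ≤-Reasoning
    ex⁅f⁆≤exC : ⁅ f ⁆ ≼ C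
    ex⁅f⁆≤exC = ≼-connected conn (f , x∈⁅x⁆ f) (⁅⁆-⊆ f∈C)
    loop-case : Loop G f → # V C ≤ # C
    loop-case loop = s≤s⁻¹ (begin
      1 + # V C       ≡⟨ cong (_+ # V C) (∣⁅x⁆∣≡1 f) ⟨
      # ⁅ f ⁆ + # V C ≤⟨ ex⁅f⁆≤exC ⟩
      # C + # V ⁅ f ⁆ ≤⟨ ℕ.+-monoʳ-≤ (# C) (∣V⁅loop⁆∣≤1 loop) ⟩
      # C + 1         ≡⟨ ℕ.+-comm (# C) 1 ⟩
      suc (# C)       ∎)
    absurd : ¬ ¬ (# V C ≤ # C)
    absurd ¬le = leafless (end₁ G f) f
      (f∈C , inj₁ refl , ¬le ∘ loop-case , λ h h∈C _ → x∈⁅y⁆⇒x≡y f (C⊆⁅f⁆ h∈C))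
      where
      C⊆⁅f⁆ : C ⊆ ⁅ f ⁆
      C⊆⁅f⁆ = leafless-⊆ conn leafless ⊆-refl (f , x∈⁅x⁆ f) (⁅⁆-⊆ f∈C) (begin
        # C + # V ⁅ f ⁆ ≤⟨ ℕ.+-monoʳ-≤ (# C) (∣V⁅⁆∣≤2 f) ⟩
        # C + 2         ≡⟨ ℕ.+-comm (# C) 2 ⟩
        suc (suc (# C)) ≤⟨ s≤s (ℕ.≰⇒> ¬le) ⟩
        1 + # V C       ≡⟨ cong (_+ # V C) (∣⁅x⁆∣≡1 f) ⟨
        # ⁅ f ⁆ + # V C ∎)

  two-cycles-excess : ∀ {A} → Connected G A → AtLeastTwoCycles G A → # V A < # A
  two-cycles-excess {A} conn (C , D , C≢D , cycC , cycD , C⊆A , D⊆A) =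
    ℕ.≰⇒> λ A≤VA → C≢D (⊆-antisym (within A≤VA cycC C⊆A cycD D⊆A) (within A≤VA cycD D⊆A cycC C⊆A))
    where
    -- From ex A ≤ 0 ≤ ex Y the cycle `Y` has full excess in `A`, so it contains the leafless `X`.
    within : # A ≤ # V A → ∀ {X Y} → Cycle G X → X ⊆ A → Cycle G Y → Y ⊆ A → X ⊆ Y
    within A≤VA {X} {Y} cX X⊆A cY@(neY , conY , _) Y⊆A =
      leafless-⊆ conn (cycle-leafless cX) X⊆A neY Y⊆A
        (ℕ.≤-trans (ℕ.+-mono-≤ A≤VA (leafless-excess neY conY (cycle-leafless cY)))
          (ℕ.≤-reflexive (ℕ.+-comm (# V A) (# Y))))

  kernel-⊆ : ∀ {A L} → Star (DeleteLeaf G) A L → L ⊆ A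
  kernel-⊆ ε = ⊆-refl
  kernel-⊆ {A} ((_ , f , _ , refl) ◅ rest) = p-x⊆p A f ∘ kernel-⊆ rest

-- The matroid M_k(G)

  module _ (k : ℕ) (1≤k : 1 ≤ k) where

    open Matroid (M k G)

    -- A minimal nonempty set satisfying the inequality satisfies the equality: deleting an edge
    -- costs one edge and adds no vertex, so a surplus would pass to a smaller set.
    circuit-in : ∀ {X} → Nonempty X → # V X + k ≤ # X → ∃ λ C → M k G C × C ⊆ X
    circuit-in = go (⊂-wellFounded _)
      where
      open ≤-Reasoning
      go : ∀ {X} → Acc _⊂_ X → Nonempty X → # V X + k ≤ # X → ∃ λ C → M k G C × C ⊆ X
      go {X} (acc rs) neX le
        with anySubset? (λ Z → (Z ⊂? X) ×-dec (nonempty? Z ×-dec (# V Z + k ≤? # Z)))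
      ... | yes (Z , Z⊂X , neZ , leZ) =
        let C , circ , C⊆Z = go (rs Z⊂X) neZ leZ in C , circ , p⊂q⇒p⊆q Z⊂X ∘ C⊆Z
      ... | no none = X , ((neX , ℕ.≤-antisym (ℕ.≮⇒≥ ¬lt) le) , minimal) , ⊆-refl
        where
        x = proj₁ neX
        ¬lt : ¬ (# V X + k < # X)
        -- Here `1 ≤ k` matters: `X - x` has at least `k` edges and is therefore nonempty.
        ¬lt lt = none (X - x , x∈p⇒p-x⊂p (proj₂ neX) , 0<∣p∣⇒Nonempty _ (ℕ.≤-trans 1≤k
            (ℕ.≤-trans (ℕ.m≤n+m k _) dense)) , dense)
          where
          dense : # V (X - x) + k ≤ # (X - x)
          dense = s≤s⁻¹ (begin
            suc (# V (X - x) + k) ≤⟨ s≤s (ℕ.+-monoˡ-≤ k (∣V∣-mono (p-x⊆p X x))) ⟩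
            suc (# V X + k)       ≤⟨ lt ⟩
            # X                   ≤⟨ ∣p∣≤1+∣p-x∣ X x ⟩
            suc (# (X - x))       ∎)
        minimal : ∀ Y → Nonempty Y × # Y ≡ # V Y + k → Y ⊆ X → Y ≡ X
        minimal Y (neY , eq) Y⊆X with X ⊆? Y
        ... | yes X⊆Y = ⊆-antisym Y⊆X X⊆Y
        ... | no X⊈Y =
          ⊥-elim (none (Y , (Y⊆X , ⊈-witness X⊈Y) , neY , ℕ.≤-reflexive (sym eq)))

    independent⇒sparse : ∀ {X Y} → Independent X → Nonempty Y → Y ⊆ X → # Y < # V Y + k
    independent⇒sparse ind neY Y⊆X = ℕ.≰⇒> λ le →
      let C , circ , C⊆Y = circuit-in neY le in ind C circ (Y⊆X ∘ C⊆Y)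

    -- Meant for `L` the kernel of `A` and `C` a fundamental circuit. What remains of `C` inside `B`
    -- has excess at least k - 1, the most that independence allows, so it must share the full
    -- excess of `A`.
    leafless-⊆-circuit : ∀ {B} → Independent B →
      ∀ {A} → A ⊆ B → Connected G A → # V A < # A →
      ∀ {L} → L ⊆ A → Leafless L →
      ∀ {f C} → M k G C → C ⊆ B ∪ ⁅ f ⁆ → L ⊆ C
    leafless-⊆-circuit {B} ind {A} A⊆B conn exA {L} L⊆A leafless {f} {C} circ@((_ , eq) , _) C⊆ =
      p-x⊆p C f ∘ p∩q⊆q A Y ∘
        leafless-⊆ conn leafless L⊆A nonempty (p∩q⊆p A Y) A≼A∩Y
      where
      open ≤-Reasoning
      Y = C - f
      Y⊆B : Y ⊆ B
      Y⊆B = ⊆-insert⁻ (C⊆ ∘ p-x⊆p C f) (x∉p-x C f)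
      exY : # V Y + k ≤ suc (# Y)
      exY = begin
        # V Y + k ≤⟨ ℕ.+-monoˡ-≤ k (∣V∣-mono (p-x⊆p C f)) ⟩
        # V C + k ≡⟨ eq ⟨
        # C       ≤⟨ ∣p∣≤1+∣p-x∣ C f ⟩
        suc (# Y) ∎
      sparse : suc (# (A ∪ Y)) ≤ # V (A ∪ Y) + k
      sparse =
        let a , a∈A = 0<∣p∣⇒Nonempty A (ℕ.≤-trans (s≤s z≤n) exA)
        in independent⇒sparse ind (a , p⊆p∪q Y a∈A) (∪-lub A⊆B Y⊆B)
      -- Supermodularity with ex Y ≥ k - 1 ≥ ex (A ∪ Y). The cancelled summand adds up the left
      -- sides of `exY` and `sparse`.
      A≼A∩Y : _≼_ A (A ∩ Y)
      A≼A∩Y = ℕ.+-cancelʳ-≤ (# V Y + k + suc (# (A ∪ Y))) _ _ (begin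
        # A + # V (A ∩ Y) + (# V Y + k + suc (# (A ∪ Y)))
          ≤⟨ ℕ.+-monoʳ-≤ (# A + # V (A ∩ Y)) (ℕ.+-mono-≤ exY sparse) ⟩
        # A + # V (A ∩ Y) + (suc (# Y) + (# V (A ∪ Y) + k))
          ≡⟨ lhs (# A) (# V (A ∩ Y)) (# Y) (# V (A ∪ Y)) k ⟩
        (# A + # Y) + (# V (A ∪ Y) + # V (A ∩ Y)) + suc k
          ≤⟨ ℕ.+-monoˡ-≤ (suc k) (ℕ.+-mono-≤
               (ℕ.≤-reflexive (sym (∣p∪q∣+∣p∩q∣≡∣p∣+∣q∣ A Y))) (∣V∣-submodular A Y)) ⟩
        (# (A ∪ Y) + # (A ∩ Y)) + (# V A + # V Y) + suc k
          ≡⟨ rhs (# (A ∪ Y)) (# (A ∩ Y)) (# V A) (# V Y) k ⟩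
        # (A ∩ Y) + # V A + (# V Y + k + suc (# (A ∪ Y))) ∎)
        where
        lhs : ∀ a i y u k → a + i + (suc y + (u + k)) ≡ (a + y) + (u + i) + suc k
        lhs = solve-∀
        rhs : ∀ u i a y k → (u + i) + (a + y) + suc k ≡ i + a + (y + k + suc u)
        rhs = solve-∀
      -- The empty set has excess 0, whereas ex A is at least 1.
      nonempty : Nonempty (A ∩ Y)
      nonempty = 0<∣p∣⇒Nonempty (A ∩ Y) (ℕ.+-cancelʳ-≤ (# V A) _ _ (begin
        suc (# V A)       ≤⟨ exA ⟩
        # A               ≤⟨ ℕ.m≤m+n _ _ ⟩
        # A + # V (A ∩ Y) ≤⟨ A≼A∩Y ⟩
        # (A ∩ Y) + # V A ∎))

    -- Both circuits have excess k and their intersection at most k - 1, so ex (C ∪ D) is at least k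
    -- + 1. Deleting `e` costs at most one, and excess k still forces a circuit.
    circuit-elimination : ∀ {C D e} → M k G C → M k G D →
      e ∈ C ∩ D → # (C ∩ D) < # V (C ∩ D) + k → ¬ Independent ((C ∪ D) - e)
    circuit-elimination {C} {D} {e} ((_ , eqC) , _) ((_ , eqD) , _) e∈ sparse ind =
      ℕ.<⇒≱ (independent⇒sparse ind nonempty ⊆-refl) dense
      where
      open ≤-Reasoning
      U = C ∪ D
      dense : # V (U - e) + k ≤ # (U - e)
      dense = ℕ.+-cancelʳ-≤ (suc (# (C ∩ D)) + # V (C ∩ D) + k) _ _ (begin
        # V (U - e) + k + (suc (# (C ∩ D)) + # V (C ∩ D) + k)
          ≤⟨ ℕ.+-monoˡ-≤ (suc (# (C ∩ D)) + # V (C ∩ D) + k) (ℕ.+-monoˡ-≤ k (∣V∣-mono (p-x⊆p U e))) ⟩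
        # V U + k + (suc (# (C ∩ D)) + # V (C ∩ D) + k)
          ≡⟨ lhs (# V U) k (# (C ∩ D)) (# V (C ∩ D)) ⟩
        (# V U + # V (C ∩ D)) + (k + k) + suc (# (C ∩ D))
          ≤⟨ ℕ.+-mono-≤ (ℕ.+-monoˡ-≤ (k + k) (∣V∣-submodular C D)) sparse ⟩
        (# V C + # V D) + (k + k) + (# V (C ∩ D) + k)
          ≡⟨ mid (# V C) (# V D) k (# V (C ∩ D)) ⟩
        (# V C + k) + (# V D + k) + (# V (C ∩ D) + k)
          ≡⟨ cong (_+ (# V (C ∩ D) + k)) (trans (cong₂ _+_ (sym eqC) (sym eqD))
               (sym (∣p∪q∣+∣p∩q∣≡∣p∣+∣q∣ C D))) ⟩
        # U + # (C ∩ D) + (# V (C ∩ D) + k)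
          ≤⟨ ℕ.+-monoˡ-≤ (# V (C ∩ D) + k) (ℕ.+-monoˡ-≤ (# (C ∩ D)) (∣p∣≤1+∣p-x∣ U e)) ⟩
        suc (# (U - e)) + # (C ∩ D) + (# V (C ∩ D) + k)
          ≡⟨ rhs (# (U - e)) (# (C ∩ D)) (# V (C ∩ D)) k ⟩
        # (U - e) + (suc (# (C ∩ D)) + # V (C ∩ D) + k) ∎)
        where
        lhs : ∀ u k i v → u + k + (suc i + v + k) ≡ (u + v) + (k + k) + suc i
        lhs = solve-∀
        mid : ∀ c d k v → (c + d) + (k + k) + (v + k) ≡ (c + k) + (d + k) + (v + k)
        mid = solve-∀
        rhs : ∀ u i v k → suc u + i + (v + k) ≡ u + (suc i + v + k)
        rhs = solve-∀
      nonempty : Nonempty (U - e)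
      nonempty = 0<∣p∣⇒Nonempty (U - e)
        (ℕ.≤-trans 1≤k (ℕ.≤-trans (ℕ.m≤n+m k (# V (U - e))) dense))

    -- Base exchange and the fundamental cocircuit

    extension-dependent : ∀ {B} → Base B → ∀ {f} → f ∉ B → ¬ Independent (B ∪ ⁅ f ⁆)
    extension-dependent {B} (_ , maxB) {f} f∉B ind =
      f∉B (subst (f ∈_) (maxB _ ind (p⊆p∪q ⁅ f ⁆)) (q⊆p∪q B ⁅ f ⁆ (x∈⁅x⁆ f)))

    independent-⊆ : ∀ {X Y} → X ⊆ Y → Independent Y → Independent X
    independent-⊆ X⊆Y ind C circ C⊆X = ind C circ (X⊆Y ∘ C⊆X)

    module _ {B : Subset m} (base : Base B) {e : Fin m} (e∈B : e ∈ B)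
      (through-e : ∀ {f C} → M k G C → C ⊆ B ∪ ⁅ f ⁆ → e ∈ C) where

      -- A circuit inside the new set would lie in `B ∪ ⁅ f ⁆` and so contain the removed `e`.
      -- Maximality is by inclusion and not by size, so it takes an elimination argument.
      swap-base : ∀ {f} → f ∉ B → Base ((B - e) ∪ ⁅ f ⁆)
      swap-base {f} f∉B = independent , maximal
        where
        ind = proj₁ base
        B′ = (B - e) ∪ ⁅ f ⁆

        e∉B′ : e ∉ B′
        e∉B′ e∈ with x∈p∪q⁻ (B - e) ⁅ f ⁆ e∈
        ... | inj₁ e∈- = x∉p-x B e e∈-
        ... | inj₂ e∈f with refl ← x∈⁅y⁆⇒x≡y f e∈f = f∉B e∈B

        B′⊆B∪f : B′ ⊆ B ∪ ⁅ f ⁆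
        B′⊆B∪f = ∪-lub (p⊆p∪q ⁅ f ⁆ ∘ p-x⊆p B e) (q⊆p∪q B ⁅ f ⁆)

        B⊆ : ∀ {Y} → B′ ⊆ Y → ∀ {x} → x ∈ B → x ≢ e → x ∈ Y
        B⊆ B′⊆Y x∈B x≢e = B′⊆Y (p⊆p∪q ⁅ f ⁆ (x∈p∧x≢y⇒x∈p-y x∈B x≢e))

        f∈B′ : f ∈ B′
        f∈B′ = q⊆p∪q (B - e) ⁅ f ⁆ (x∈⁅x⁆ f)

        independent : Independent B′
        independent C circ C⊆ = e∉B′ (C⊆ (through-e circ (B′⊆B∪f ∘ C⊆)))

        no-extension : ∀ {Y g} → Independent Y → B′ ⊆ Y → g ∈ Y → g ∉ B′ → ⊥
        no-extension {Y} {g} indY B′⊆Y g∈Y g∉B′ with g ≟ e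
        -- With `e` restored, `Y` contains the dependent set `B ∪ ⁅ f ⁆`.
        ... | yes refl = extension-dependent base f∉B
          (independent-⊆ (∪-lub B⊆Y (⁅⁆-⊆ (B′⊆Y f∈B′))) indY)
          where
          B⊆Y : B ⊆ Y
          B⊆Y {x} x∈B with x ≟ e
          ... | yes refl = g∈Y
          ... | no x≢e = B⊆ B′⊆Y x∈B x≢e
        -- The goal is absurdity, so each failure of independence may hand over a circuit: `C` in
        -- `B ∪ ⁅ f ⁆` and `D` in `B ∪ ⁅ g ⁆`. Both pass through `e`, and eliminating `e` stays
        -- inside `Y`.
        ... | no g≢e = extension-dependent base f∉B λ C circC C⊆ →
          extension-dependent base g∉B λ D circD D⊆ →
          circuit-elimination circC circD
            (x∈p∩q⁺ (through-e circC C⊆ , through-e circD D⊆))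
            (independent⇒sparse ind
              (e , x∈p∩q⁺ (through-e circC C⊆ , through-e circD D⊆)) (meet C⊆ D⊆))
            (independent-⊆ (join C⊆ D⊆) indY)
          where
          g∉B : g ∉ B
          g∉B g∈B = g∉B′ (p⊆p∪q ⁅ f ⁆ (x∈p∧x≢y⇒x∈p-y g∈B g≢e))
          meet : ∀ {C D} → C ⊆ B ∪ ⁅ f ⁆ → D ⊆ B ∪ ⁅ g ⁆ → C ∩ D ⊆ B
          meet {C} {D} C⊆ D⊆ x∈ with x∈C , x∈D ← x∈p∩q⁻ C D x∈
            with x∈p∪q⁻ B ⁅ f ⁆ (C⊆ x∈C) | x∈p∪q⁻ B ⁅ g ⁆ (D⊆ x∈D)
          ... | inj₁ x∈B | _ = x∈B
          ... | inj₂ _ | inj₁ x∈B = x∈B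
          -- Here `f` and `g` would coincide, but only `f` lies in `B′`.
          ... | inj₂ x∈f | inj₂ x∈g
            with refl ← x∈⁅y⁆⇒x≡y f x∈f | refl ← x∈⁅y⁆⇒x≡y g x∈g = contradiction f∈B′ g∉B′
          join : ∀ {C D} → C ⊆ B ∪ ⁅ f ⁆ → D ⊆ B ∪ ⁅ g ⁆ → (C ∪ D) - e ⊆ Y
          join {C} {D} C⊆ D⊆ {x} x∈ with x ≟ e
          ... | yes refl = contradiction x∈ (x∉p-x (C ∪ D) e)
          ... | no x≢e with x∈p∪q⁻ C D (p-x⊆p (C ∪ D) e x∈)
          ...   | inj₁ x∈C with x∈p∪q⁻ B ⁅ f ⁆ (C⊆ x∈C)
          ...     | inj₁ x∈B = B⊆ B′⊆Y x∈B x≢e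
          ...     | inj₂ x∈f = ⁅⁆-⊆ (B′⊆Y f∈B′) x∈f
          join {C} {D} C⊆ D⊆ {x} x∈ | no x≢e | inj₂ x∈D with x∈p∪q⁻ B ⁅ g ⁆ (D⊆ x∈D)
          ...     | inj₁ x∈B = B⊆ B′⊆Y x∈B x≢e
          ...     | inj₂ x∈g = ⁅⁆-⊆ g∈Y x∈g

        maximal : ∀ Y → Independent Y → B′ ⊆ Y → Y ≡ B′
        maximal Y indY B′⊆Y with Y ⊆? B′
        ... | yes Y⊆B′ = ⊆-antisym Y⊆B′ B′⊆Y
        ... | no Y⊈B′ with g , g∈Y , g∉B′ ← ⊈-witness Y⊈B′ =
          ⊥-elim (no-extension indY B′⊆Y g∈Y g∉B′)

      -- Coindependence means being avoided by some base. A base avoiding the whole set would lie in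
      -- `B`, hence equal `B`, yet miss `e`. A subset lacking `e` is avoided by `B`, and one lacking
      -- some `f ∉ B` by the swapped base.
      fundamental-cocircuit : IsFundamentalCocircuit e B (∁ B ∪ ⁅ e ⁆)
      fundamental-cocircuit = (dependent , minimal) , K∩B≡e , unique
        where
        K = ∁ B ∪ ⁅ e ⁆

        e∈K : e ∈ K
        e∈K = q⊆p∪q (∁ B) ⁅ e ⁆ (x∈⁅x⁆ e)

        dependent : ¬ Coindependent K
        dependent (B′ , (ind′ , max′) , K⊆∁B′) =
          x∈∁p⇒x∉p (K⊆∁B′ e∈K) (subst (e ∈_) (max′ B (proj₁ base) B′⊆B) e∈B)
          where
          B′⊆B : B′ ⊆ B
          B′⊆B = ∁p⊆∁q⇒p⊇q (K⊆∁B′ ∘ p⊆p∪q ⁅ e ⁆)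

        minimal : ∀ X → ¬ Coindependent X → X ⊆ K → X ≡ K
        minimal X depX X⊆K = ⊆-antisym X⊆K (∪-lub ∁B⊆X (⁅⁆-⊆ e∈X))
          where
          e∈X : e ∈ X
          e∈X = decidable-stable (e ∈? X) λ e∉X → depX (B , base , ⊆-insert⁻ X⊆K e∉X)
          ∁B⊆X : ∁ B ⊆ X
          ∁B⊆X {f} f∈∁B = decidable-stable (f ∈? X) λ f∉X →
            depX (_ , swap-base (x∈∁p⇒x∉p f∈∁B) , λ {x} x∈X → x∉p⇒x∈∁p λ x∈B′ →
              avoid f∉X x∈X (x∈p∪q⁻ (B - e) ⁅ f ⁆ x∈B′) (x∈p∪q⁻ (∁ B) ⁅ e ⁆ (X⊆K x∈X)))
            where
            avoid : ∀ {x} → f ∉ X → x ∈ X → x ∈ B - e ⊎ x ∈ ⁅ f ⁆ → x ∈ ∁ B ⊎ x ∈ ⁅ e ⁆ → ⊥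
            avoid f∉X x∈X (inj₁ x∈-) (inj₁ x∈∁) = x∈∁p⇒x∉p x∈∁ (p-x⊆p B e x∈-)
            avoid f∉X x∈X (inj₁ x∈-) (inj₂ x∈e) with refl ← x∈⁅y⁆⇒x≡y e x∈e = x∉p-x B e x∈-
            avoid f∉X x∈X (inj₂ x∈f) _ with refl ← x∈⁅y⁆⇒x≡y f x∈f = f∉X x∈X

        K∩B≡e : K ∩ B ≡ ⁅ e ⁆
        K∩B≡e = ⊆-antisym K∩B⊆e (⁅⁆-⊆ (x∈p∩q⁺ (e∈K , e∈B)))
          where
          K∩B⊆e : K ∩ B ⊆ ⁅ e ⁆
          K∩B⊆e x∈ with x∈K , x∈B ← x∈p∩q⁻ K B x∈ with x∈p∪q⁻ (∁ B) ⁅ e ⁆ x∈K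
          ... | inj₁ x∈∁B = contradiction x∈B (x∈∁p⇒x∉p x∈∁B)
          ... | inj₂ x∈e = x∈e

        unique : ∀ K′ → Cocircuit K′ → K′ ∩ B ≡ ⁅ e ⁆ → K′ ≡ K
        -- Meeting `B` only in `e` confines `K′` to `K`, whose minimality finishes.
        unique K′ (dep′ , _) K′∩B≡e = minimal K′ dep′ K′⊆K
          where
          K′⊆K : K′ ⊆ K
          K′⊆K {x} x∈K′ with x ∈? B
          ... | yes x∈B = q⊆p∪q (∁ B) ⁅ e ⁆ (subst (x ∈_) K′∩B≡e (x∈p∩q⁺ (x∈K′ , x∈B)))
          ... | no x∉B = p⊆p∪q ⁅ e ⁆ (x∉p⇒x∈∁p x∉B)

mainTheorem20 : ∀ {n m : ℕ} (G : Graph n m) (k : ℕ) → 1 ≤ k →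
    Matroid.ConnectedMatroid (M k G) →
    ∀ (B : Subset m) → Matroid.Base (M k G) B →
    ∀ (e : Fin m) → e ∈ B →
    ∀ (A : Subset m) → ComponentOf G B A → e ∈ A →
    AtLeastTwoCycles G A →
    ∀ (L : Subset m) → IsKernel G A L → e ∈ L →
    Matroid.IsFundamentalCocircuit (M k G) e B (∁ B ∪ ⁅ e ⁆)
mainTheorem20 G k 1≤k _ B base e e∈B A ((A⊆B , _ , conn) , _) _ twoCycles L (deletions , leafless) e∈L =
  -- The graph enters only here: every circuit in `B ∪ ⁅ f ⁆` contains the kernel, and with it `e`.
  fundamental-cocircuit G k 1≤k base e∈B λ circ C⊆ →
    leafless-⊆-circuit G k 1≤k (proj₁ base) A⊆B conn (two-cycles-excess G conn twoCycles)
      (kernel-⊆ G deletions) leafless circ C⊆ e∈L
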